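{- For a positive integer $m$, an $(m,4,3)$-PSDS exists if and only if $m\geq 5$.
   Context: Let $m,k,c$ be positive integers. An $(m,k,c)$-perfect system of difference sets (regular PSDS with threshold $c$) is a collection $\mathcal A$ of $m$ sets of nonnegative integers, each of size $k$, such that the multiset $\bigcup_{A\in\mathcal A}\{x-y: x,y\in A,\ x>y\}$ covers every element of $\{c,c+1,\dots,c-1+m\binom{k}{2}\}$ exactly once. -}

module Defs where

open import Data.Nat using (ℕ; _+_; _*_; ∣_-_∣)
open import Data.Nat.Combinatorics using (_C_)
open import Data.List using (List; []; _∷_; map; _++_; concatMap; upTo)
open import Data.List.Relation.Unary.Unique.Propositional using (Unique)
open import Data.List.Relation.Binary.Permutation.Propositional using (_↭_)
open import Data.Vec using (Vec; toList)
open import Data.Product using (_×_; Σ)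
import Data.Vec.Relation.Unary.All as VAll

-- Positive differences x - y (x > y) over all unordered pairs of a list.
-- For a list with distinct entries, this is exactly the multiset
-- { x - y : x, y ∈ A, x > y }.
pairDiffs : List ℕ → List ℕ
pairDiffs []       = []
pairDiffs (x ∷ xs) = map (λ y → ∣ x - y ∣) xs ++ pairDiffs xs

IsKSet : {k : ℕ} → Vec ℕ k → Set
IsKSet A = Unique (toList A)

systemDiffs : {m k : ℕ} → Vec (Vec ℕ k) m → List ℕ
systemDiffs 𝒜 = concatMap (λ A → pairDiffs (toList A)) (toList 𝒜)

targetRange : (m k c : ℕ) → List ℕ
targetRange m k c = map (c +_) (upTo (m * (k C 2)))

IsPSDS : (m k c : ℕ) → Vec (Vec ℕ k) m → Set
IsPSDS m k c 𝒜 = VAll.All IsKSet 𝒜 × (systemDiffs 𝒜 ↭ targetRange m k c)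

PSDSExists : (m k c : ℕ) → Set
PSDSExists m k c = Σ (Vec (Vec ℕ k) m) (IsPSDS m k c)

{-# OPTIONS --safe #-}

-- Lower bound.  In a block with consecutive gaps a, b, c the longest difference is a + b + c.
-- The m longest differences sum to at most the m largest elements of the range, the 3m gaps to at
-- least the 3m smallest ones, and comparing the two sums gives m ≥ 5.
--
-- Existence.  For m ≥ 26 write m = s + 6n with 26 ≤ s ≤ 31.  Most blocks come in six strands: the
-- vertices of the i-th block of a strand (i < n) are n x_k + v_k i + e_k, where the slopes v_k are
-- a permutation of 0, 1, 2, 3.  The six differences of a strand are then arithmetic progressions
-- with steps ±1, ±2, ±3.  Progressions with step ±1 fill intervals of length n, pairs with step ±2
-- interleave to intervals of length 2n and triples with step ±3 to intervals of length 3n; the x_k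
-- and e_k are chosen so that these intervals tile the range up to gaps of bounded length, at
-- positions n j + o with j ≤ 36.  Finally s further blocks fill these gaps.  Everything is linear
-- in n, so that for each s one finite check covers all n.  The six sets of parameters, and the
-- systems for 5 ≤ m ≤ 25, were found by computer search.

module Submission where

open import Defs
open import Data.Nat using (ℕ; _≥_; _>_)
open import Function.Bundles using (_⇔_)

open import Data.List using (List; []; _∷_; map; _++_; concatMap; length; upTo)
open import Data.List.Membership.Propositional using (_∈_)
open import Data.List.Membership.Propositional.Properties using (∈-∃++; ∈-++⁺ˡ; ∈-++⁺ʳ; ∈-++⁻; ∈-map⁺; ∈-map⁻; ∈-upTo⁺; ∈-upTo⁻)
open import Data.List.Properties using (length-++; length-map; length-upTo; map-++; map-concatMap; concatMap-cong; concatMap-map; concatMap-++)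
open import Data.List.Relation.Binary.Permutation.Propositional using (_↭_; ↭-refl; ↭-sym; ↭-trans; ↭-reflexive; prep; swap; refl) renaming (trans to ↭trans)
open import Data.List.Relation.Binary.Permutation.Propositional.Properties using (shift; shifts; ++⁺ˡ; ++⁺ʳ; map⁺; ↭-length; All-resp-↭)
open import Data.List.Relation.Unary.All as All using (All; []; _∷_)
import Data.List.Relation.Unary.All.Properties as All
open import Data.List.Relation.Unary.AllPairs using ([]; _∷_)
open import Data.List.Relation.Unary.Any using (here; there)
open import Data.List.Relation.Unary.Linked using (Linked; [-]; _∷_)
open import Data.List.Relation.Unary.Unique.Propositional using (Unique)
open import Data.List.Relation.Unary.Unique.Propositional.Properties using (upTo⁺) renaming (map⁺ to Unique-map⁺)
open import Data.Nat using (zero; suc; _+_; _*_; _∸_; ∣_-_∣; _≤_; _<_; z≤n; s≤s; _≟_; _≤?_; _<?_)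
open import Data.Nat.DivMod using (_/_; _%_; m≡m%n+[m/n]*n; m%n<n; m<n*o⇒m/o<n)
open import Data.Nat.ListAction using (sum)
open import Data.Nat.ListAction.Properties using (sum-++; sum-↭)
open import Data.Nat.Properties hiding (_≟_; _≤?_; _<?_)
open import Data.Nat.Tactic.RingSolver using (solve-∀)
open import Data.Product using (_×_; _,_; proj₁; proj₂)
open import Data.Product.Properties using (≡-dec)
open import Data.Sum using (_⊎_; inj₁; inj₂; [_,_]′)
open import Data.Vec using (Vec; []; _∷_; toList; fromList)
import Data.Vec as Vec
import Data.Vec.Relation.Unary.All as VAll
open import Function using (_∘_; flip)
open import Function.Bundles using (mk⇔)
open import Relation.Binary.PropositionalEquality using (_≡_; refl; sym; trans; cong; cong₂; subst)
open import Relation.Nullary using (Dec; yes; no; ¬_; contradiction)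
open import Relation.Nullary.Decidable using (from-yes; from-no; _×-dec_; _⊎-dec_)
open import Data.List.Sort ≤-decTotalOrder using (sort; sort-↭; sort-↗)

private variable
  A B : Set

-- The bound m ≥ 5

pairDiffs-↭ : {xs ys : List ℕ} → xs ↭ ys → pairDiffs xs ↭ pairDiffs ys
pairDiffs-↭ refl = ↭-refl
pairDiffs-↭ (prep {xs} {ys} x p) =
  ↭-trans (++⁺ʳ (pairDiffs xs) (map⁺ ∣ x -_∣ p)) (++⁺ˡ (map ∣ x -_∣ ys) (pairDiffs-↭ p))
pairDiffs-↭ (swap {xs} {ys} x y p) =
  ↭-trans (↭-reflexive (cong (_∷ map ∣ x -_∣ xs ++ map ∣ y -_∣ xs ++ pairDiffs xs) (∣-∣-comm x y)))
    (prep ∣ y - x ∣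
      (↭-trans (shifts (map ∣ x -_∣ xs) (map ∣ y -_∣ xs))
        (↭-trans (++⁺ʳ _ (map⁺ ∣ y -_∣ p))
          (++⁺ˡ (map ∣ y -_∣ ys)
            (↭-trans (++⁺ʳ _ (map⁺ ∣ x -_∣ p))
              (++⁺ˡ (map ∣ x -_∣ ys) (pairDiffs-↭ p)))))))
pairDiffs-↭ (↭trans p q) = ↭-trans (pairDiffs-↭ p) (pairDiffs-↭ q)

module _ (λ′ μ : ℕ) where

  penalty : ℕ → ℕ
  penalty d = (d ∸ λ′) + (μ ∸ d)

  totalPenalty : List ℕ → ℕ
  totalPenalty = sum ∘ map penalty

  totalPenalty-↭ : ∀ {xs ys} → xs ↭ ys → totalPenalty xs ≡ totalPenalty ys
  totalPenalty-↭ p = sum-↭ (map⁺ penalty p)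

  long-penalty : ∀ d → d ≤ λ′ + penalty d
  long-penalty d = ≤-trans (m≤n+m∸n d λ′) (+-monoʳ-≤ λ′ (m≤m+n _ _))

  short-penalty : ∀ d → μ ≤ d + penalty d
  short-penalty d = ≤-trans (m≤n+m∸n μ d) (+-monoʳ-≤ d (m≤n+m _ _))

  -- In a sorted block the longest difference is the sum of the three consecutive ones.
  sorted-penalty : ∀ {w x y z} → w ≤ x → x ≤ y → y ≤ z →
    μ + μ + μ ≤ λ′ + totalPenalty (pairDiffs (w ∷ x ∷ y ∷ z ∷ []))
  sorted-penalty {w} {x} {y} {z} w≤x x≤y y≤z = +-cancelˡ-≤ (a + b + c) _ _ (begin
    a + b + c + (μ + μ + μ)
      ≤⟨ +-mono-≤ (≤-trans (≤-reflexive sum-gaps) (long-penalty t))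
           (+-mono-≤ (+-mono-≤ (short-penalty a) (short-penalty b)) (short-penalty c)) ⟩
    (λ′ + P t) + ((a + P a) + (b + P b) + (c + P c))
      ≤⟨ m≤m+n _ (P u + P v) ⟩
    (λ′ + P t) + ((a + P a) + (b + P b) + (c + P c)) + (P u + P v)
      ≡⟨ regroup a b c λ′ (P a) (P u) (P t) (P b) (P v) (P c) ⟩
    a + b + c + (λ′ + totalPenalty (pairDiffs (w ∷ x ∷ y ∷ z ∷ []))) ∎)
    where
    open ≤-Reasoning
    P = penalty
    a = ∣ w - x ∣
    b = ∣ x - y ∣
    c = ∣ y - z ∣
    t = ∣ w - z ∣
    u = ∣ w - y ∣
    v = ∣ x - z ∣

    triangle : ∀ {p q r} → p ≤ q → q ≤ r → ∣ p - q ∣ + ∣ q - r ∣ ≡ ∣ p - r ∣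
    triangle {p} p≤q q≤r with q′ , refl ← m≤n⇒∃[o]m+o≡n p≤q with r′ , refl ← m≤n⇒∃[o]m+o≡n q≤r =
      trans (cong₂ _+_ (∣m-m+n∣≡n p q′) (∣m-m+n∣≡n (p + q′) r′))
        (trans (sym (∣m-m+n∣≡n p (q′ + r′))) (cong ∣ p -_∣ (sym (+-assoc p q′ r′))))

    sum-gaps : a + b + c ≡ t
    sum-gaps = trans (cong (_+ c) (triangle w≤x x≤y)) (triangle (≤-trans w≤x x≤y) y≤z)

    regroup : ∀ a b c l pa pu pt pb pv pc →
      (l + pt) + ((a + pa) + (b + pb) + (c + pc)) + (pu + pv)
      ≡ a + b + c + (l + (pa + (pu + (pt + (pb + (pv + (pc + 0)))))))
    regroup = solve-∀

  block-penalty : (V : Vec ℕ 4) → μ + μ + μ ≤ λ′ + totalPenalty (pairDiffs (toList V))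
  block-penalty V@(_ ∷ _ ∷ _ ∷ _ ∷ []) =
    subst (λ p → μ + μ + μ ≤ λ′ + p) (totalPenalty-↭ (pairDiffs-↭ (sort-↭ (toList V))))
      (go (sort (toList V)) (↭-length (sort-↭ (toList V))) (sort-↗ (toList V)))
    where
    go : ∀ xs → length xs ≡ 4 → Linked _≤_ xs → μ + μ + μ ≤ λ′ + totalPenalty (pairDiffs xs)
    go (w ∷ x ∷ y ∷ z ∷ []) refl (w≤x ∷ x≤y ∷ y≤z ∷ [-]) = sorted-penalty w≤x x≤y y≤z

  system-penalty : ∀ {m} (𝒜 : Vec (Vec ℕ 4) m) →
    m * (μ + μ + μ) ≤ m * λ′ + totalPenalty (systemDiffs 𝒜)
  system-penalty [] = z≤n
  system-penalty {suc m} (V ∷ 𝒜) = begin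
    (μ + μ + μ) + m * (μ + μ + μ)
      ≤⟨ +-mono-≤ (block-penalty V) (system-penalty 𝒜) ⟩
    (λ′ + totalPenalty D) + (m * λ′ + totalPenalty E)
      ≡⟨ interchange λ′ (totalPenalty D) (m * λ′) (totalPenalty E) ⟩
    (λ′ + m * λ′) + (totalPenalty D + totalPenalty E)
      ≡⟨ cong (λ′ + m * λ′ +_) (sym (trans (cong sum (map-++ penalty D E)) (sum-++ (map penalty D) _))) ⟩
    (λ′ + m * λ′) + totalPenalty (D ++ E) ∎
    where
    open ≤-Reasoning
    D = pairDiffs (toList V)
    E = systemDiffs 𝒜

    interchange : ∀ a b c d → (a + b) + (c + d) ≡ (a + c) + (b + d)
    interchange = solve-∀

-- λ′ and μ separate the m largest and the 3m smallest elements of the range.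
PenaltyBound : ℕ → Set
PenaltyBound m = m * (μ + μ + μ) ≤ m * λ′ + totalPenalty λ′ μ (targetRange m 4 3)
  where
  λ′ = 5 * m + 2
  μ = 3 * m + 3

penaltyBound : ∀ m → PSDSExists m 4 3 → PenaltyBound m
penaltyBound m (𝒜 , _ , p) =
  subst (λ q → m * (μ + μ + μ) ≤ m * λ′ + q) (totalPenalty-↭ λ′ μ p) (system-penalty λ′ μ 𝒜)
  where
  λ′ = 5 * m + 2
  μ = 3 * m + 3

penaltyBound? : ∀ m → Dec (PenaltyBound m)
penaltyBound? m = _ ≤? _

PSDS⇒≥5 : ∀ m → m > 0 → PSDSExists m 4 3 → m ≥ 5
PSDS⇒≥5 1 _ = flip contradiction (from-no (penaltyBound? 1)) ∘ penaltyBound 1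
PSDS⇒≥5 2 _ = flip contradiction (from-no (penaltyBound? 2)) ∘ penaltyBound 2
PSDS⇒≥5 3 _ = flip contradiction (from-no (penaltyBound? 3)) ∘ penaltyBound 3
PSDS⇒≥5 4 _ = flip contradiction (from-no (penaltyBound? 4)) ∘ penaltyBound 4
PSDS⇒≥5 (suc (suc (suc (suc (suc m))))) _ _ = m≤m+n 5 m

-- Systems from lists of gaps

↭-covering : {xs ys : List A} → Unique ys → All (_∈ xs) ys → length xs ≡ length ys → xs ↭ ys
↭-covering {xs = []} [] [] _ = ↭-refl
↭-covering {xs = xs} {y ∷ ys} (y∉ys ∷ uniq) (y∈xs ∷ ys⊆xs) len
  with as , bs , refl ← ∈-∃++ y∈xs =
  ↭-trans (shift y as bs) (prep y (↭-covering uniq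
    (All.zipWith (λ (y≢v , v∈) → remove y≢v v∈) (y∉ys , ys⊆xs))
    (suc-injective (trans (sym (↭-length (shift y as bs))) len))))
  where
  remove : ∀ {v} → ¬ y ≡ v → v ∈ as ++ y ∷ bs → v ∈ as ++ bs
  remove y≢v v∈ with ∈-++⁻ as v∈
  ... | inj₁ v∈as = ∈-++⁺ˡ v∈as
  ... | inj₂ (here v≡y) = contradiction (sym v≡y) y≢v
  ... | inj₂ (there v∈bs) = ∈-++⁺ʳ as v∈bs

Triple : Set → Set
Triple A = A × A × A

map₃ : (A → B) → Triple A → Triple B
map₃ f (a , b , c) = f a , f b , f c

gapDiffs : (A → A → A) → Triple A → List A
gapDiffs _∙_ (a , b , c) = a ∷ a ∙ b ∷ a ∙ (b ∙ c) ∷ b ∷ b ∙ c ∷ c ∷ []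

allGapDiffs : (A → A → A) → List (Triple A) → List A
allGapDiffs _∙_ = concatMap (gapDiffs _∙_)

allGapDiffs-map : (_∙_ : A → A → A) (f : A → ℕ) → (∀ x y → f (x ∙ y) ≡ f x + f y) →
  ∀ gs → map f (allGapDiffs _∙_ gs) ≡ allGapDiffs _+_ (map (map₃ f) gs)
allGapDiffs-map _∙_ f hom gs =
  trans (map-concatMap f (gapDiffs _∙_) gs)
    (trans (concatMap-cong gapDiffs-map gs) (sym (concatMap-map (gapDiffs _+_) (map₃ f) gs)))
  where
  gapDiffs-map : ∀ g → map f (gapDiffs _∙_ g) ≡ gapDiffs _+_ (map₃ f g)
  gapDiffs-map (a , b , c)
    rewrite hom a (b ∙ c) | hom a b | hom b c = refl

block : Triple ℕ → Vec ℕ 4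
block (a , b , c) = 0 ∷ a ∷ a + b ∷ a + (b + c) ∷ []

pairDiffs-block : ∀ g → pairDiffs (toList (block g)) ≡ gapDiffs _+_ g
pairDiffs-block (a , b , c)
  rewrite ∣m-m+n∣≡n a b | ∣m-m+n∣≡n a (b + c) | ∣m+n-m+o∣≡∣n-o∣ a b (b + c) | ∣m-m+n∣≡n b c = refl

system : (gs : List (Triple ℕ)) → Vec (Vec ℕ 4) (length gs)
system gs = Vec.map block (fromList gs)

systemDiffs-system : ∀ gs → systemDiffs (system gs) ≡ allGapDiffs _+_ gs
systemDiffs-system [] = refl
systemDiffs-system (g ∷ gs) = cong₂ _++_ (pairDiffs-block g) (systemDiffs-system gs)

length-allGapDiffs : ∀ gs → length (allGapDiffs _+_ gs) ≡ length gs * 6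
length-allGapDiffs [] = refl
length-allGapDiffs (g ∷ gs) = cong (6 +_) (length-allGapDiffs gs)

pairDiffs>0⇒Unique : ∀ xs → All (_> 0) (pairDiffs xs) → Unique xs
pairDiffs>0⇒Unique [] _ = []
pairDiffs>0⇒Unique (x ∷ xs) pos =
  All.map (λ {y} d>0 x≡y → <-irrefl (sym (m≡n⇒∣m-n∣≡0 x≡y)) d>0) (All.map⁻ (All.++⁻ˡ _ pos))
  ∷ pairDiffs>0⇒Unique xs (All.++⁻ʳ (map ∣ x -_∣ xs) pos)

systemDiffs>0⇒IsKSet : ∀ {m k} (𝒜 : Vec (Vec ℕ k) m) →
  All (_> 0) (systemDiffs 𝒜) → VAll.All IsKSet 𝒜
systemDiffs>0⇒IsKSet [] _ = VAll.[]
systemDiffs>0⇒IsKSet (V ∷ 𝒜) pos =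
  pairDiffs>0⇒Unique (toList V) (All.++⁻ˡ _ pos)
  VAll.∷ systemDiffs>0⇒IsKSet 𝒜 (All.++⁻ʳ (pairDiffs (toList V)) pos)

Covering : List (Triple ℕ) → Set
Covering gs = All (_∈ allGapDiffs _+_ gs) (targetRange (length gs) 4 3)

covering? : ∀ gs → Dec (Covering gs)
covering? gs = All.all? (_∈? allGapDiffs _+_ gs) _
  where open import Data.List.Membership.DecPropositional _≟_

covering⇒PSDS : ∀ gs → Covering gs → PSDSExists (length gs) 4 3
covering⇒PSDS gs cov = system gs , systemDiffs>0⇒IsKSet (system gs) positive , perm
  where
  range = targetRange (length gs) 4 3

  perm : systemDiffs (system gs) ↭ range
  perm = subst (_↭ range) (sym (systemDiffs-system gs))
    (↭-covering (Unique-map⁺ (+-cancelˡ-≡ 3 _ _) (upTo⁺ _)) cov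
      (trans (length-allGapDiffs gs)
        (sym (trans (length-map (3 +_) (upTo (length gs * 6))) (length-upTo _)))))

  positive : All (_> 0) (systemDiffs (system gs))
  positive = All-resp-↭ (↭-sym perm) (All.map⁺ (All.universal (λ _ → s≤s z≤n) _))

-- Systems depending on a parameter n

-- (j , o) stands for n * j + o.
Level : Set
Level = ℕ × ℕ

_⊕ᴸ_ : Level → Level → Level
(j , o) ⊕ᴸ (k , p) = j + k , o + p

_at_ : Level → ℕ → ℕ
(j , o) at n = n * j + o

-- (p , q , r) stands for p * i + q * i′ + r, where i + suc i′ ≡ n.
Form : Set
Form = ℕ × ℕ × ℕ

_⊕ᶠ_ : Form → Form → Form
(p , q , r) ⊕ᶠ (p′ , q′ , r′) = p + p′ , q + q′ , r + r′

Row : Set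
Row = ℕ × ℕ

_on_ : Form → Row → ℕ
(p , q , r) on (i , i′) = p * i + q * i′ + r

at-⊕ᴸ : ∀ n k l → (k ⊕ᴸ l) at n ≡ k at n + l at n
at-⊕ᴸ n (j , o) (k , p) = lemma n j k o p
  where
  lemma : ∀ n j k o p → n * (j + k) + (o + p) ≡ (n * j + o) + (n * k + p)
  lemma = solve-∀

on-⊕ᶠ : ∀ ρ f g → (f ⊕ᶠ g) on ρ ≡ f on ρ + g on ρ
on-⊕ᶠ (i , i′) (p , q , r) (p′ , q′ , r′) = lemma i i′ p q r p′ q′ r′
  where
  lemma : ∀ i i′ p q r p′ q′ r′ →
    (p + p′) * i + (q + q′) * i′ + (r + r′) ≡ (p * i + q * i′ + r) + (p′ * i + q′ * i′ + r′)
  lemma = solve-∀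

rows : ℕ → List Row
rows n = map (λ i → i , n ∸ suc i) (upTo n)

∈-rows : ∀ i i′ → (i , i′) ∈ rows (i + suc i′)
∈-rows i i′ = subst (λ k → (i , k) ∈ rows (i + suc i′)) eq
  (∈-map⁺ (λ k → k , i + suc i′ ∸ suc k) (∈-upTo⁺ (m<m+n i (s≤s z≤n))))
  where
  eq : i + suc i′ ∸ suc i ≡ i′
  eq = trans (cong (_∸ suc i) (+-suc i i′)) (m+n∸m≡n i i′)

record Template : Set where
  field
    strands : List (Triple Form)
    fill    : List (Triple Level)
    steps   : List (ℕ × ℕ)

  strandForms : List Form
  strandForms = allGapDiffs _⊕ᶠ_ strands

  fillLevels : List Level
  fillLevels = allGapDiffs _⊕ᴸ_ fill

  strandRow : Row → List (Triple ℕ)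
  strandRow ρ = map (map₃ (_on ρ)) strands

  gaps : ℕ → List (Triple ℕ)
  gaps n = map (map₃ (_at n)) fill ++ concatMap strandRow (rows n)

  length-gaps : ∀ n → length (gaps n) ≡ length fill + n * length strands
  length-gaps n = trans (length-++ (map _ fill))
    (cong₂ _+_ (length-map _ fill)
      (trans (length-rows (rows n))
        (cong (_* length strands) (trans (length-map _ (upTo n)) (length-upTo n)))))
    where
    length-rows : ∀ ρs → length (concatMap strandRow ρs) ≡ length ρs * length strands
    length-rows [] = refl
    length-rows (ρ ∷ ρs) =
      trans (length-++ (strandRow ρ)) (cong₂ _+_ (length-map _ strands) (length-rows ρs))

  Hit : Level → Set
  Hit l = l ∈ fillLevels

  -- The progression n * j + o + δ + σ * k for k < n, run through with i = k or with i′ = k.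
  Run : ℕ → Level → ℕ → Set
  Run σ (j , o) δ = (j + σ , j , j + o + δ) ∈ strandForms ⊎ (j , j + σ , j + o + δ) ∈ strandForms

  -- A step (g , σ) covers g consecutive values by filling blocks and the next n * σ ones by strands.
  Path : List (ℕ × ℕ) → Level → Level → Set
  Path [] l l′ = l ≡ l′
  Path ((g , σ) ∷ ss) (j , o) l′ =
    All (λ k → Hit (j , o + k)) (upTo g)
    × All (Run σ (j , o + g)) (upTo σ)
    × Path ss (j + σ , o + g) l′

  module _ (n : ℕ) where

    D : List ℕ
    D = allGapDiffs _+_ (gaps n)

    Hit⇒∈ : ∀ {l} → Hit l → l at n ∈ D
    Hit⇒∈ {l} l∈ =
      subst (l at n ∈_) (sym (concatMap-++ (gapDiffs _+_) (map (map₃ (_at n)) fill) _))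
      (∈-++⁺ˡ (subst (l at n ∈_) (allGapDiffs-map _⊕ᴸ_ (_at n) (at-⊕ᴸ n) fill) (∈-map⁺ (_at n) l∈)))

    strandForm⇒∈ : ∀ {f ρ} → f ∈ strandForms → ρ ∈ rows n → f on ρ ∈ D
    strandForm⇒∈ {f} {ρ} f∈ ρ∈ =
      subst (f on ρ ∈_) (sym (concatMap-++ (gapDiffs _+_) (map (map₃ (_at n)) fill) _))
        (∈-++⁺ʳ (allGapDiffs _+_ (map (map₃ (_at n)) fill)) (in-rows ρ∈))
      where
      in-row : f on ρ ∈ allGapDiffs _+_ (strandRow ρ)
      in-row = subst (f on ρ ∈_) (allGapDiffs-map _⊕ᶠ_ (_on ρ) (on-⊕ᶠ ρ) strands) (∈-map⁺ (_on ρ) f∈)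

      in-rows : ∀ {ρs} → ρ ∈ ρs → f on ρ ∈ allGapDiffs _+_ (concatMap strandRow ρs)
      in-rows {ρ′ ∷ _} ρ∈ =
        subst (f on ρ ∈_) (sym (concatMap-++ (gapDiffs _+_) (strandRow ρ′) _)) (split ρ∈)
        where
        split : ∀ {ρs} → ρ ∈ ρ′ ∷ ρs →
          f on ρ ∈ allGapDiffs _+_ (strandRow ρ′) ++ allGapDiffs _+_ (concatMap strandRow ρs)
        split (here refl) = ∈-++⁺ˡ in-row
        split (there ρ∈) = ∈-++⁺ʳ (allGapDiffs _+_ (strandRow ρ′)) (in-rows ρ∈)

    Covers : ℕ → ℕ → Set
    Covers x y = ∀ v → x ≤ v → v < y → v ∈ D

    Covers-trans : ∀ {x y z} → Covers x y → Covers y z → Covers x z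
    Covers-trans {y = y} c d v x≤v v<z with v <? y
    ... | yes v<y = c v x≤v v<y
    ... | no  v≮y = d v (≮⇒≥ v≮y) v<z

    hits⇒covers : ∀ g j o → All (λ k → Hit (j , o + k)) (upTo g) →
      Covers ((j , o) at n) ((j , o + g) at n)
    hits⇒covers g j o hs v lo hi with k , refl ← m≤n⇒∃[o]m+o≡n lo =
      subst (_∈ D) (sym (+-assoc (n * j) o k)) (Hit⇒∈ (All.lookup hs (∈-upTo⁺ k<g)))
      where
      k<g : k < g
      k<g = +-cancelˡ-< (n * j + o) k g
        (subst (n * j + o + k <_) (sym (+-assoc (n * j) o g)) hi)

    runs⇒covers : ∀ σ j o → All (Run σ (j , o)) (upTo σ) →
      Covers ((j , o) at n) ((j + σ , o) at n)
    runs⇒covers σ j o rs v lo hi with r , refl ← m≤n⇒∃[o]m+o≡n lo = go σ rs r<nσ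
      where
      r<nσ : r < n * σ
      r<nσ = +-cancelˡ-< (n * j + o) r (n * σ) (subst (n * j + o + r <_) (lemma n j σ o) hi)
        where
        lemma : ∀ n j σ o → n * (j + σ) + o ≡ n * j + o + n * σ
        lemma = solve-∀

      go : ∀ σ → All (Run σ (j , o)) (upTo σ) → r < n * σ → n * j + o + r ∈ D
      go zero _ r<0 = contradiction (subst (r <_) (*-zeroʳ n) r<0) λ ()
      go σ@(suc _) rs r<nσ with i′ , eq ← m≤n⇒∃[o]m+o≡n (m<n*o⇒m/o<n {r} {n} {σ} r<nσ) =
        [ (λ f∈ → subst (_∈ D) value₁ (strandForm⇒∈ f∈ row₁))
        , (λ f∈ → subst (_∈ D) value₂ (strandForm⇒∈ f∈ row₂))
        ]′ (All.lookup rs (∈-upTo⁺ (m%n<n r σ)))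
        where
        i = r / σ
        δ = r % σ

        n≡ : n ≡ i + suc i′
        n≡ = trans (sym eq) (sym (+-suc i i′))

        row₁ : (i , i′) ∈ rows n
        row₁ = subst (λ n → (i , i′) ∈ rows n) (sym n≡) (∈-rows i i′)

        row₂ : (i′ , i) ∈ rows n
        row₂ = subst (λ n → (i′ , i) ∈ rows n) (trans (+-comm i′ (suc i)) eq) (∈-rows i′ i)

        target : (i + suc i′) * j + o + (δ + i * σ) ≡ n * j + o + r
        target = cong₂ (λ n r → n * j + o + r) (sym n≡) (sym (m≡m%n+[m/n]*n r σ))

        value₁ : (j + σ , j , j + o + δ) on (i , i′) ≡ n * j + o + r
        value₁ = trans (lemma j σ o δ i i′) target
          where
          lemma : ∀ j σ o δ i i′ →
            (j + σ) * i + j * i′ + (j + o + δ) ≡ (i + suc i′) * j + o + (δ + i * σ)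
          lemma = solve-∀

        value₂ : (j , j + σ , j + o + δ) on (i′ , i) ≡ n * j + o + r
        value₂ = trans (lemma j σ o δ i i′) target
          where
          lemma : ∀ j σ o δ i i′ →
            j * i′ + (j + σ) * i + (j + o + δ) ≡ (i + suc i′) * j + o + (δ + i * σ)
          lemma = solve-∀

    path⇒covers : ∀ ss {l l′} → Path ss l l′ → Covers (l at n) (l′ at n)
    path⇒covers [] refl v lo hi = contradiction hi (≤⇒≯ lo)
    path⇒covers ((g , σ) ∷ ss) {j , o} (hs , rs , p) =
      Covers-trans (hits⇒covers g j o hs)
        (Covers-trans (runs⇒covers σ j (o + g) rs) (path⇒covers ss p))

  _∈ᶠ?_ : ∀ f fs → Dec (f ∈ fs)
  _∈ᶠ?_ = _∈?_
    where open import Data.List.Membership.DecPropositional (≡-dec _≟_ (≡-dec _≟_ _≟_))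

  _∈ᴸ?_ : ∀ l ls → Dec (l ∈ ls)
  _∈ᴸ?_ = _∈?_
    where open import Data.List.Membership.DecPropositional (≡-dec _≟_ _≟_)

  run? : ∀ σ l δ → Dec (Run σ l δ)
  run? σ (j , o) δ =
    ((j + σ , j , j + o + δ) ∈ᶠ? strandForms) ⊎-dec ((j , j + σ , j + o + δ) ∈ᶠ? strandForms)

  path? : ∀ ss l l′ → Dec (Path ss l l′)
  path? [] l l′ = ≡-dec _≟_ _≟_ l l′
  path? ((g , σ) ∷ ss) (j , o) l′ =
    All.all? (λ k → (j , o + k) ∈ᴸ? fillLevels) (upTo g)
    ×-dec All.all? (run? σ (j , o + g)) (upTo σ)
    ×-dec path? ss (j + σ , o + g) l′

  Valid : ℕ → Set
  Valid s = length fill ≡ s × length strands ≡ 6 × Path steps (0 , 3) (36 , 3 + s * 6)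

  valid? : ∀ s → Dec (Valid s)
  valid? s = length fill ≟ s ×-dec length strands ≟ 6 ×-dec path? steps (0 , 3) (36 , 3 + s * 6)

  valid⇒PSDS : ∀ {s} → Valid s → ∀ n → PSDSExists (s + n * 6) 4 3
  valid⇒PSDS {s} (lenᶠ , lenˢ , path) n =
    subst (λ m → PSDSExists m 4 3) len (covering⇒PSDS (gaps n) (All.tabulate covered))
    where
    len : length (gaps n) ≡ s + n * 6
    len = trans (length-gaps n) (cong₂ (λ f k → f + n * k) lenᶠ lenˢ)

    end : ∀ n s → 3 + (s + n * 6) * 6 ≡ n * 36 + (3 + s * 6)
    end = solve-∀

    covered : ∀ {v} → v ∈ targetRange (length (gaps n)) 4 3 → v ∈ D n
    covered v∈ with k , k∈ , refl ← ∈-map⁻ (3 +_) v∈ =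
      path⇒covers n steps path (3 + k) (≤-trans (≤-reflexive (cong (_+ 3) (*-zeroʳ n))) (m≤m+n 3 k))
        (subst (3 + k <_) (trans (cong (λ m → 3 + m * 6) len) (end n s)) (+-monoʳ-< 3 (∈-upTo⁻ k∈)))

-- small k has 5 + k blocks.
small : ℕ → List (Triple ℕ)
small 0 =
  (3 , 16 , 9) ∷ (4 , 17 , 10) ∷ (5 , 13 , 11) ∷ (6 , 14 , 12) ∷ (7 , 15 , 8) ∷ []
small 1 =
  (3 , 16 , 17) ∷ (4 , 18 , 10) ∷ (5 , 20 , 9) ∷ (6 , 24 , 7) ∷ (8 , 13 , 14) ∷
  (12 , 11 , 15) ∷ []
small 2 =
  (3 , 28 , 8) ∷ (5 , 24 , 11) ∷ (6 , 21 , 17) ∷ (7 , 25 , 9) ∷ (10 , 13 , 20) ∷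
  (12 , 14 , 16) ∷ (15 , 4 , 18) ∷ []
small 3 =
  (3 , 22 , 21) ∷ (4 , 36 , 5) ∷ (7 , 24 , 11) ∷ (8 , 30 , 9) ∷ (13 , 19 , 18) ∷
  (14 , 6 , 28) ∷ (15 , 12 , 17) ∷ (16 , 10 , 23) ∷ []
small 4 =
  (3 , 47 , 5) ∷ (4 , 30 , 12) ∷ (6 , 25 , 13) ∷ (8 , 24 , 17) ∷ (9 , 18 , 21) ∷
  (10 , 23 , 20) ∷ (11 , 29 , 16) ∷ (14 , 22 , 15) ∷ (19 , 7 , 28) ∷ []
small 5 =
  (3 , 36 , 12) ∷ (4 , 15 , 42) ∷ (5 , 26 , 24) ∷ (6 , 22 , 32) ∷ (7 , 33 , 13) ∷
  (8 , 30 , 11) ∷ (9 , 20 , 27) ∷ (10 , 35 , 17) ∷ (14 , 23 , 21) ∷ (16 , 18 , 25) ∷ []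
small 6 =
  (3 , 44 , 14) ∷ (4 , 5 , 55) ∷ (6 , 32 , 27) ∷ (7 , 34 , 12) ∷ (8 , 31 , 18) ∷
  (10 , 33 , 19) ∷ (11 , 24 , 21) ∷ (13 , 29 , 25) ∷ (15 , 22 , 26) ∷ (16 , 20 , 30) ∷
  (17 , 23 , 28) ∷ []
small 7 =
  (3 , 28 , 35) ∷ (6 , 41 , 14) ∷ (7 , 43 , 15) ∷ (8 , 4 , 60) ∷ (9 , 39 , 23) ∷
  (10 , 32 , 17) ∷ (11 , 27 , 30) ∷ (13 , 33 , 21) ∷ (18 , 34 , 22) ∷ (19 , 25 , 26) ∷
  (20 , 16 , 37) ∷ (24 , 5 , 40) ∷ []
small 8 =
  (3 , 44 , 29) ∷ (4 , 36 , 23) ∷ (5 , 34 , 30) ∷ (6 , 49 , 12) ∷ (7 , 11 , 54) ∷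
  (8 , 45 , 21) ∷ (9 , 33 , 37) ∷ (10 , 17 , 41) ∷ (14 , 38 , 19) ∷ (15 , 16 , 46) ∷
  (20 , 28 , 32) ∷ (22 , 13 , 43) ∷ (24 , 26 , 25) ∷ []
small 9 =
  (3 , 51 , 25) ∷ (4 , 65 , 9) ∷ (5 , 35 , 31) ∷ (6 , 14 , 50) ∷ (7 , 39 , 36) ∷
  (8 , 34 , 15) ∷ (10 , 28 , 24) ∷ (11 , 47 , 26) ∷ (13 , 43 , 29) ∷ (16 , 37 , 30) ∷
  (17 , 44 , 19) ∷ (18 , 41 , 27) ∷ (21 , 12 , 48) ∷ (22 , 23 , 32) ∷ []
small 10 =
  (3 , 37 , 44) ∷ (4 , 59 , 8) ∷ (6 , 12 , 42) ∷ (7 , 31 , 45) ∷ (9 , 56 , 24) ∷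
  (10 , 52 , 26) ∷ (11 , 36 , 28) ∷ (13 , 21 , 48) ∷ (14 , 43 , 30) ∷ (15 , 55 , 22) ∷
  (16 , 35 , 39) ∷ (19 , 49 , 23) ∷ (20 , 41 , 25) ∷ (27 , 5 , 53) ∷ (29 , 17 , 33) ∷ []
small 11 =
  (3 , 57 , 31) ∷ (5 , 61 , 23) ∷ (6 , 16 , 36) ∷ (7 , 70 , 15) ∷ (8 , 35 , 33) ∷
  (9 , 37 , 50) ∷ (10 , 45 , 26) ∷ (11 , 40 , 39) ∷ (12 , 62 , 21) ∷ (13 , 41 , 32) ∷
  (17 , 47 , 18) ∷ (19 , 48 , 27) ∷ (20 , 49 , 29) ∷ (24 , 14 , 42) ∷ (25 , 28 , 44) ∷
  (30 , 4 , 59) ∷ []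
small 12 =
  (4 , 69 , 20) ∷ (5 , 51 , 41) ∷ (8 , 47 , 33) ∷ (9 , 7 , 37) ∷ (10 , 52 , 25) ∷
  (11 , 57 , 28) ∷ (12 , 38 , 36) ∷ (13 , 59 , 31) ∷ (14 , 67 , 17) ∷ (15 , 30 , 49) ∷
  (18 , 60 , 22) ∷ (19 , 29 , 54) ∷ (21 , 6 , 64) ∷ (23 , 42 , 34) ∷ (24 , 39 , 32) ∷
  (26 , 40 , 35) ∷ (43 , 3 , 58) ∷ []
small 13 =
  (3 , 16 , 68) ∷ (4 , 41 , 7) ∷ (5 , 67 , 31) ∷ (6 , 69 , 27) ∷ (8 , 66 , 25) ∷
  (9 , 44 , 37) ∷ (10 , 49 , 51) ∷ (11 , 65 , 28) ∷ (12 , 24 , 56) ∷ (14 , 43 , 40) ∷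
  (17 , 46 , 32) ∷ (18 , 55 , 34) ∷ (20 , 50 , 35) ∷ (21 , 58 , 30) ∷ (22 , 60 , 26) ∷
  (23 , 38 , 33) ∷ (29 , 13 , 64) ∷ (39 , 15 , 47) ∷ []
small 14 =
  (5 , 68 , 30) ∷ (6 , 41 , 11) ∷ (7 , 27 , 66) ∷ (9 , 69 , 19) ∷ (12 , 75 , 14) ∷
  (13 , 16 , 79) ∷ (15 , 36 , 63) ∷ (17 , 65 , 25) ∷ (18 , 67 , 24) ∷ (20 , 74 , 22) ∷
  (21 , 55 , 37) ∷ (23 , 48 , 33) ∷ (26 , 54 , 32) ∷ (28 , 44 , 39) ∷ (31 , 46 , 38) ∷
  (35 , 10 , 60) ∷ (40 , 3 , 59) ∷ (42 , 8 , 56) ∷ (49 , 4 , 57) ∷ []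
small 15 =
  (3 , 56 , 63) ∷ (4 , 16 , 52) ∷ (6 , 91 , 14) ∷ (7 , 53 , 47) ∷ (9 , 73 , 26) ∷
  (11 , 78 , 24) ∷ (12 , 25 , 50) ∷ (13 , 77 , 27) ∷ (15 , 49 , 31) ∷ (17 , 79 , 22) ∷
  (18 , 65 , 33) ∷ (21 , 71 , 23) ∷ (28 , 57 , 36) ∷ (29 , 40 , 41) ∷ (30 , 46 , 38) ∷
  (32 , 54 , 34) ∷ (35 , 8 , 66) ∷ (39 , 5 , 62) ∷ (42 , 19 , 51) ∷ (45 , 10 , 48) ∷ []
small 16 =
  (3 , 38 , 35) ∷ (5 , 39 , 69) ∷ (6 , 45 , 66) ∷ (7 , 53 , 18) ∷ (9 , 4 , 55) ∷
  (10 , 62 , 42) ∷ (11 , 43 , 64) ∷ (12 , 77 , 20) ∷ (14 , 81 , 21) ∷ (15 , 84 , 26) ∷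
  (16 , 47 , 58) ∷ (17 , 83 , 23) ∷ (19 , 74 , 27) ∷ (22 , 65 , 25) ∷ (24 , 70 , 33) ∷
  (28 , 52 , 46) ∷ (29 , 50 , 36) ∷ (30 , 61 , 31) ∷ (32 , 56 , 40) ∷ (34 , 48 , 37) ∷
  (49 , 8 , 67) ∷ []
small 17 =
  (3 , 82 , 31) ∷ (5 , 44 , 75) ∷ (7 , 87 , 28) ∷ (8 , 50 , 53) ∷ (9 , 39 , 42) ∷
  (10 , 11 , 55) ∷ (12 , 84 , 25) ∷ (14 , 38 , 80) ∷ (15 , 74 , 36) ∷ (16 , 79 , 33) ∷
  (19 , 78 , 20) ∷ (22 , 70 , 35) ∷ (23 , 83 , 24) ∷ (26 , 73 , 27) ∷ (29 , 62 , 40) ∷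
  (30 , 63 , 41) ∷ (32 , 56 , 45) ∷ (34 , 17 , 69) ∷ (37 , 6 , 65) ∷ (46 , 18 , 59) ∷
  (47 , 13 , 54) ∷ (57 , 4 , 68) ∷ []
small 18 =
  (4 , 77 , 39) ∷ (6 , 61 , 64) ∷ (7 , 5 , 66) ∷ (8 , 91 , 24) ∷ (9 , 53 , 59) ∷
  (10 , 88 , 26) ∷ (11 , 49 , 70) ∷ (13 , 97 , 25) ∷ (14 , 29 , 47) ∷ (15 , 94 , 23) ∷
  (16 , 85 , 33) ∷ (17 , 52 , 20) ∷ (19 , 32 , 75) ∷ (21 , 84 , 22) ∷ (27 , 68 , 34) ∷
  (28 , 80 , 31) ∷ (35 , 65 , 38) ∷ (36 , 56 , 48) ∷ (37 , 46 , 50) ∷ (40 , 18 , 55) ∷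
  (41 , 45 , 42) ∷ (44 , 30 , 63) ∷ (54 , 3 , 79) ∷ []
small 19 =
  (4 , 52 , 71) ∷ (5 , 49 , 66) ∷ (6 , 68 , 8) ∷ (9 , 78 , 53) ∷ (10 , 88 , 45) ∷
  (11 , 80 , 37) ∷ (12 , 3 , 40) ∷ (13 , 96 , 26) ∷ (14 , 48 , 63) ∷ (17 , 85 , 27) ∷
  (18 , 89 , 30) ∷ (20 , 79 , 39) ∷ (21 , 73 , 51) ∷ (22 , 83 , 31) ∷ (23 , 70 , 33) ∷
  (24 , 77 , 29) ∷ (25 , 61 , 60) ∷ (28 , 67 , 46) ∷ (32 , 72 , 38) ∷ (35 , 7 , 90) ∷
  (36 , 64 , 44) ∷ (41 , 16 , 59) ∷ (47 , 34 , 58) ∷ (50 , 19 , 65) ∷ []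
small 20 =
  (5 , 65 , 14) ∷ (6 , 4 , 54) ∷ (7 , 62 , 73) ∷ (8 , 67 , 74) ∷ (12 , 101 , 20) ∷
  (13 , 103 , 27) ∷ (16 , 94 , 28) ∷ (17 , 102 , 21) ∷ (18 , 77 , 50) ∷ (19 , 96 , 29) ∷
  (22 , 83 , 24) ∷ (23 , 97 , 31) ∷ (26 , 66 , 34) ∷ (30 , 78 , 40) ∷ (32 , 57 , 42) ∷
  (33 , 71 , 43) ∷ (35 , 76 , 41) ∷ (36 , 25 , 63) ∷ (37 , 56 , 53) ∷ (38 , 68 , 44) ∷
  (39 , 47 , 51) ∷ (45 , 15 , 72) ∷ (46 , 9 , 81) ∷ (48 , 11 , 80) ∷ (49 , 3 , 82) ∷ []
small _ = []

-- template r yields systems of 26 + r + 6n blocks.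
template : ℕ → Template
template 0 = record
  { strands =
      ((3 , 0 , 7) , (19 , 21 , 108) , (14 , 13 , 74)) ∷
      ((18 , 15 , 89) , (11 , 13 , 64) , (7 , 6 , 35)) ∷
      ((13 , 11 , 65) , (5 , 4 , 26) , (9 , 11 , 53)) ∷
      ((3 , 0 , 9) , (23 , 25 , 129) , (6 , 5 , 29)) ∷
      ((3 , 4 , 19) , (18 , 15 , 90) , (7 , 8 , 40)) ∷
      ((3 , 0 , 8) , (8 , 9 , 46) , (22 , 23 , 122)) ∷ []
  ; fill =
      ((0 , 3) , (23 , 101) , (6 , 24)) ∷ ((0 , 4) , (15 , 68) , (19 , 81)) ∷
      ((0 , 5) , (23 , 100) , (9 , 38)) ∷ ((0 , 6) , (25 , 106) , (5 , 23)) ∷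
      ((3 , 7) , (15 , 73) , (18 , 74)) ∷ ((3 , 8) , (15 , 71) , (18 , 77)) ∷
      ((3 , 9) , (27 , 121) , (3 , 15)) ∷ ((3 , 10) , (19 , 87) , (11 , 47)) ∷
      ((3 , 11) , (11 , 51) , (18 , 75)) ∷ ((3 , 12) , (3 , 13) , (19 , 85)) ∷
      ((3 , 14) , (4 , 16) , (21 , 93)) ∷ ((4 , 17) , (4 , 20) , (22 , 96)) ∷
      ((4 , 18) , (15 , 65) , (13 , 57)) ∷ ((4 , 21) , (11 , 45) , (19 , 86)) ∷
      ((5 , 22) , (21 , 92) , (6 , 28)) ∷ ((6 , 26) , (19 , 82) , (7 , 31)) ∷
      ((6 , 27) , (9 , 43) , (18 , 76)) ∷ ((7 , 29) , (14 , 61) , (9 , 42)) ∷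
      ((7 , 32) , (11 , 46) , (11 , 49)) ∷ ((8 , 33) , (15 , 69) , (13 , 55)) ∷
      ((8 , 34) , (11 , 50) , (15 , 67)) ∷ ((8 , 35) , (13 , 56) , (13 , 59)) ∷
      ((9 , 39) , (4 , 19) , (9 , 41)) ∷ ((9 , 40) , (13 , 54) , (14 , 64)) ∷
      ((11 , 44) , (14 , 63) , (11 , 48)) ∷ ((11 , 52) , (8 , 36) , (13 , 53)) ∷ []
  ; steps =
      (4 , 3) ∷ (9 , 1) ∷ (6 , 1) ∷ (2 , 1) ∷ (5 , 1) ∷ (4 , 1) ∷ (5 , 1) ∷ (6 , 2) ∷ (9 , 2) ∷
      (8 , 1) ∷ (4 , 1) ∷ (9 , 3) ∷ (7 , 1) ∷ (8 , 2) ∷ (5 , 1) ∷ (6 , 1) ∷ (6 , 2) ∷ (7 , 1) ∷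
      (5 , 1) ∷ (4 , 1) ∷ (3 , 1) ∷ (4 , 1) ∷ (8 , 2) ∷ (7 , 1) ∷ (5 , 1) ∷ (5 , 2) ∷ (5 , 0) ∷
      []
  }
template 1 = record
  { strands =
      ((3 , 0 , 6) , (19 , 21 , 111) , (14 , 13 , 74)) ∷
      ((18 , 15 , 90) , (11 , 13 , 66) , (7 , 6 , 36)) ∷
      ((13 , 11 , 65) , (5 , 4 , 27) , (9 , 11 , 53)) ∷
      ((3 , 0 , 8) , (23 , 25 , 132) , (6 , 5 , 30)) ∷
      ((3 , 4 , 19) , (18 , 15 , 91) , (7 , 8 , 42)) ∷
      ((3 , 0 , 7) , (8 , 9 , 47) , (22 , 23 , 124)) ∷ []
  ; fill =
      ((0 , 3) , (25 , 110) , (4 , 18)) ∷ ((0 , 4) , (19 , 85) , (13 , 56)) ∷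
      ((0 , 5) , (13 , 54) , (14 , 65)) ∷ ((3 , 6) , (15 , 74) , (18 , 77)) ∷
      ((3 , 7) , (15 , 68) , (15 , 71)) ∷ ((3 , 8) , (23 , 107) , (6 , 25)) ∷
      ((3 , 9) , (15 , 73) , (18 , 76)) ∷ ((3 , 10) , (27 , 123) , (3 , 15)) ∷
      ((3 , 11) , (18 , 81) , (5 , 24)) ∷ ((3 , 14) , (3 , 13) , (22 , 99)) ∷
      ((4 , 16) , (19 , 88) , (13 , 55)) ∷ ((4 , 19) , (11 , 48) , (21 , 94)) ∷
      ((4 , 20) , (7 , 33) , (25 , 111)) ∷ ((4 , 21) , (11 , 49) , (7 , 30)) ∷
      ((4 , 22) , (11 , 44) , (19 , 90)) ∷ ((5 , 23) , (18 , 83) , (11 , 46)) ∷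
      ((6 , 26) , (21 , 95) , (9 , 42)) ∷ ((6 , 28) , (19 , 86) , (9 , 41)) ∷
      ((6 , 29) , (21 , 91) , (7 , 34)) ∷ ((7 , 32) , (7 , 31) , (19 , 87)) ∷
      ((8 , 35) , (13 , 58) , (9 , 43)) ∷ ((8 , 36) , (15 , 72) , (11 , 45)) ∷
      ((8 , 37) , (11 , 47) , (11 , 51)) ∷ ((8 , 38) , (3 , 12) , (22 , 97)) ∷
      ((9 , 40) , (14 , 62) , (13 , 60)) ∷ ((11 , 52) , (4 , 17) , (14 , 61)) ∷
      ((13 , 57) , (9 , 39) , (14 , 64)) ∷ []
  ; steps =
      (3 , 3) ∷ (10 , 1) ∷ (7 , 1) ∷ (2 , 1) ∷ (5 , 1) ∷ (5 , 1) ∷ (4 , 1) ∷ (5 , 2) ∷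
      (10 , 2) ∷ (7 , 1) ∷ (5 , 1) ∷ (9 , 3) ∷ (9 , 1) ∷ (7 , 2) ∷ (5 , 1) ∷ (6 , 1) ∷
      (7 , 2) ∷ (6 , 1) ∷ (4 , 1) ∷ (6 , 1) ∷ (3 , 1) ∷ (5 , 1) ∷ (7 , 2) ∷ (6 , 1) ∷ (6 , 1) ∷
      (5 , 2) ∷ (8 , 0) ∷ []
  }
template 2 = record
  { strands =
      ((3 , 0 , 7) , (19 , 21 , 115) , (14 , 13 , 77)) ∷
      ((18 , 15 , 93) , (11 , 13 , 68) , (7 , 6 , 37)) ∷
      ((13 , 11 , 69) , (5 , 4 , 26) , (9 , 11 , 56)) ∷
      ((3 , 0 , 9) , (23 , 25 , 137) , (6 , 5 , 31)) ∷
      ((3 , 4 , 20) , (18 , 15 , 94) , (7 , 8 , 42)) ∷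
      ((3 , 0 , 8) , (8 , 9 , 49) , (22 , 23 , 127)) ∷ []
  ; fill =
      ((0 , 4) , (25 , 113) , (9 , 46)) ∷ ((0 , 5) , (19 , 89) , (13 , 57)) ∷
      ((3 , 7) , (15 , 76) , (18 , 81)) ∷ ((3 , 8) , (15 , 70) , (15 , 75)) ∷
      ((3 , 9) , (15 , 77) , (18 , 79)) ∷ ((3 , 10) , (25 , 120) , (5 , 22)) ∷
      ((3 , 11) , (25 , 118) , (5 , 25)) ∷ ((3 , 12) , (18 , 84) , (9 , 43)) ∷
      ((3 , 13) , (22 , 101) , (7 , 33)) ∷ ((3 , 14) , (23 , 110) , (7 , 34)) ∷
      ((3 , 15) , (18 , 80) , (11 , 53)) ∷ ((3 , 16) , (11 , 48) , (15 , 74)) ∷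
      ((4 , 17) , (4 , 18) , (15 , 73)) ∷ ((4 , 19) , (23 , 109) , (9 , 41)) ∷
      ((4 , 21) , (15 , 71) , (7 , 31)) ∷ ((5 , 23) , (8 , 36) , (19 , 90)) ∷
      ((5 , 24) , (6 , 27) , (22 , 104)) ∷ ((6 , 26) , (19 , 93) , (11 , 47)) ∷
      ((6 , 29) , (19 , 87) , (11 , 54)) ∷ ((7 , 32) , (14 , 65) , (8 , 38)) ∷
      ((8 , 37) , (6 , 30) , (15 , 69)) ∷ ((8 , 40) , (13 , 58) , (13 , 63)) ∷
      ((9 , 42) , (4 , 20) , (23 , 105)) ∷ ((9 , 44) , (6 , 28) , (13 , 60)) ∷
      ((9 , 45) , (14 , 66) , (11 , 49)) ∷ ((11 , 50) , (0 , 6) , (23 , 106)) ∷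
      ((11 , 52) , (0 , 3) , (18 , 82)) ∷ ((13 , 61) , (8 , 39) , (15 , 68)) ∷ []
  ; steps =
      (4 , 3) ∷ (10 , 1) ∷ (5 , 1) ∷ (4 , 1) ∷ (5 , 1) ∷ (4 , 1) ∷ (6 , 1) ∷ (6 , 2) ∷
      (10 , 2) ∷ (7 , 1) ∷ (4 , 1) ∷ (10 , 3) ∷ (9 , 1) ∷ (8 , 2) ∷ (6 , 1) ∷ (4 , 1) ∷
      (8 , 2) ∷ (8 , 1) ∷ (4 , 1) ∷ (4 , 1) ∷ (4 , 1) ∷ (6 , 1) ∷ (7 , 2) ∷ (6 , 1) ∷ (7 , 1) ∷
      (5 , 2) ∷ (7 , 0) ∷ []
  }
template 3 = record
  { strands =
      ((3 , 0 , 9) , (19 , 21 , 115) , (14 , 13 , 78)) ∷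
      ((18 , 15 , 95) , (11 , 13 , 70) , (7 , 6 , 38)) ∷
      ((13 , 11 , 69) , (5 , 4 , 27) , (9 , 11 , 57)) ∷
      ((3 , 0 , 7) , (23 , 25 , 140) , (6 , 5 , 32)) ∷
      ((3 , 4 , 20) , (18 , 15 , 94) , (7 , 8 , 45)) ∷
      ((3 , 0 , 8) , (8 , 9 , 50) , (22 , 23 , 130)) ∷ []
  ; fill =
      ((0 , 3) , (25 , 118) , (5 , 25)) ∷ ((0 , 4) , (28 , 132) , (6 , 30)) ∷
      ((0 , 5) , (21 , 96) , (13 , 64)) ∷ ((0 , 6) , (11 , 48) , (23 , 113)) ∷
      ((3 , 8) , (23 , 115) , (6 , 27)) ∷ ((3 , 9) , (15 , 70) , (15 , 78)) ∷
      ((3 , 10) , (11 , 57) , (18 , 82)) ∷ ((3 , 11) , (23 , 111) , (6 , 29)) ∷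
      ((3 , 12) , (19 , 93) , (7 , 33)) ∷ ((3 , 13) , (15 , 71) , (4 , 19)) ∷
      ((3 , 14) , (23 , 110) , (7 , 35)) ∷ ((3 , 15) , (8 , 40) , (25 , 116)) ∷
      ((3 , 16) , (4 , 20) , (21 , 97)) ∷ ((4 , 17) , (9 , 44) , (23 , 108)) ∷
      ((4 , 21) , (11 , 51) , (18 , 86)) ∷ ((5 , 23) , (22 , 104) , (7 , 37)) ∷
      ((5 , 24) , (14 , 68) , (11 , 52)) ∷ ((5 , 26) , (18 , 83) , (9 , 46)) ∷
      ((6 , 28) , (21 , 102) , (9 , 45)) ∷ ((7 , 32) , (4 , 18) , (11 , 56)) ∷
      ((7 , 34) , (14 , 66) , (11 , 53)) ∷ ((8 , 38) , (15 , 76) , (11 , 49)) ∷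
      ((8 , 39) , (13 , 59) , (15 , 75)) ∷ ((8 , 41) , (13 , 58) , (15 , 77)) ∷
      ((9 , 42) , (9 , 47) , (18 , 81)) ∷ ((9 , 43) , (14 , 69) , (13 , 62)) ∷
      ((13 , 60) , (6 , 31) , (13 , 63)) ∷ ((14 , 65) , (4 , 22) , (18 , 85)) ∷
      ((15 , 73) , (3 , 7) , (18 , 88)) ∷ []
  ; steps =
      (4 , 3) ∷ (10 , 1) ∷ (6 , 1) ∷ (4 , 1) ∷ (5 , 1) ∷ (6 , 1) ∷ (4 , 1) ∷ (6 , 2) ∷
      (10 , 2) ∷ (7 , 1) ∷ (5 , 1) ∷ (9 , 3) ∷ (11 , 1) ∷ (5 , 2) ∷ (8 , 1) ∷ (5 , 1) ∷
      (8 , 2) ∷ (6 , 1) ∷ (5 , 1) ∷ (5 , 1) ∷ (5 , 1) ∷ (6 , 1) ∷ (6 , 2) ∷ (7 , 1) ∷ (4 , 1) ∷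
      (8 , 2) ∷ (9 , 0) ∷ []
  }
template 4 = record
  { strands =
      ((3 , 0 , 10) , (19 , 21 , 123) , (14 , 13 , 84)) ∷
      ((18 , 15 , 102) , (11 , 13 , 74) , (7 , 6 , 40)) ∷
      ((13 , 11 , 75) , (5 , 4 , 28) , (9 , 11 , 63)) ∷
      ((3 , 0 , 8) , (23 , 25 , 149) , (6 , 5 , 36)) ∷
      ((3 , 4 , 23) , (18 , 15 , 101) , (7 , 8 , 47)) ∷
      ((3 , 0 , 9) , (8 , 9 , 53) , (22 , 23 , 139)) ∷ []
  ; fill =
      ((0 , 4) , (11 , 56) , (15 , 79)) ∷ ((0 , 5) , (23 , 117) , (9 , 45)) ∷
      ((0 , 6) , (25 , 125) , (9 , 50)) ∷ ((3 , 8) , (23 , 124) , (6 , 31)) ∷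
      ((3 , 9) , (15 , 77) , (15 , 84)) ∷ ((3 , 10) , (15 , 85) , (18 , 87)) ∷
      ((3 , 11) , (19 , 101) , (11 , 57)) ∷ ((3 , 12) , (15 , 81) , (14 , 72)) ∷
      ((3 , 13) , (15 , 78) , (7 , 38)) ∷ ((3 , 14) , (4 , 20) , (18 , 94)) ∷
      ((3 , 15) , (0 , 3) , (26 , 134)) ∷ ((3 , 16) , (8 , 42) , (21 , 106)) ∷
      ((3 , 17) , (22 , 113) , (5 , 30)) ∷ ((3 , 19) , (18 , 88) , (9 , 52)) ∷
      ((4 , 22) , (9 , 47) , (14 , 73)) ∷ ((4 , 23) , (4 , 21) , (21 , 105)) ∷
      ((5 , 24) , (14 , 75) , (9 , 46)) ∷ ((5 , 25) , (13 , 64) , (15 , 82)) ∷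
      ((5 , 26) , (18 , 92) , (11 , 62)) ∷ ((5 , 27) , (14 , 76) , (13 , 65)) ∷
      ((5 , 28) , (8 , 40) , (21 , 110)) ∷ ((5 , 29) , (21 , 109) , (7 , 35)) ∷
      ((6 , 32) , (9 , 51) , (19 , 96)) ∷ ((6 , 33) , (13 , 67) , (13 , 66)) ∷
      ((7 , 36) , (11 , 54) , (11 , 61)) ∷ ((7 , 37) , (14 , 71) , (9 , 48)) ∷
      ((8 , 41) , (7 , 39) , (19 , 97)) ∷ ((9 , 49) , (14 , 74) , (11 , 53)) ∷
      ((11 , 55) , (8 , 43) , (11 , 59)) ∷ ((13 , 63) , (0 , 7) , (21 , 104)) ∷ []
  ; steps =
      (5 , 3) ∷ (12 , 1) ∷ (4 , 1) ∷ (7 , 1) ∷ (3 , 1) ∷ (6 , 1) ∷ (5 , 1) ∷ (8 , 2) ∷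
      (10 , 2) ∷ (8 , 1) ∷ (6 , 1) ∷ (9 , 3) ∷ (10 , 1) ∷ (8 , 2) ∷ (8 , 1) ∷ (5 , 1) ∷
      (8 , 2) ∷ (7 , 1) ∷ (8 , 1) ∷ (4 , 1) ∷ (4 , 1) ∷ (8 , 1) ∷ (6 , 2) ∷ (7 , 1) ∷ (5 , 1) ∷
      (8 , 2) ∷ (1 , 0) ∷ []
  }
template 5 = record
  { strands =
      ((3 , 0 , 8) , (19 , 21 , 124) , (14 , 13 , 82)) ∷
      ((18 , 15 , 100) , (11 , 13 , 74) , (7 , 6 , 39)) ∷
      ((13 , 11 , 73) , (5 , 4 , 29) , (9 , 11 , 61)) ∷
      ((3 , 0 , 9) , (23 , 25 , 148) , (6 , 5 , 33)) ∷
      ((3 , 4 , 22) , (18 , 15 , 101) , (7 , 8 , 46)) ∷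
      ((3 , 0 , 10) , (8 , 9 , 52) , (22 , 23 , 137)) ∷ []
  ; fill =
      ((0 , 3) , (25 , 126) , (4 , 21)) ∷ ((0 , 4) , (21 , 105) , (9 , 47)) ∷
      ((0 , 5) , (13 , 63) , (21 , 110)) ∷ ((0 , 6) , (19 , 97) , (13 , 62)) ∷
      ((0 , 7) , (23 , 115) , (13 , 66)) ∷ ((3 , 8) , (15 , 84) , (18 , 87)) ∷
      ((3 , 9) , (15 , 76) , (15 , 82)) ∷ ((3 , 10) , (11 , 61) , (18 , 90)) ∷
      ((3 , 11) , (15 , 83) , (18 , 86)) ∷ ((3 , 12) , (19 , 99) , (6 , 31)) ∷
      ((3 , 13) , (11 , 56) , (15 , 80)) ∷ ((3 , 14) , (3 , 15) , (30 , 155)) ∷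
      ((3 , 16) , (18 , 91) , (11 , 57)) ∷ ((3 , 17) , (8 , 43) , (25 , 125)) ∷
      ((3 , 18) , (22 , 113) , (5 , 26)) ∷ ((4 , 22) , (4 , 19) , (15 , 79)) ∷
      ((4 , 23) , (7 , 36) , (23 , 117)) ∷ ((4 , 24) , (23 , 116) , (9 , 46)) ∷
      ((5 , 25) , (14 , 75) , (9 , 44)) ∷ ((5 , 27) , (14 , 74) , (11 , 53)) ∷
      ((6 , 28) , (13 , 67) , (13 , 65)) ∷ ((6 , 30) , (15 , 78) , (11 , 55)) ∷
      ((6 , 32) , (13 , 64) , (15 , 81)) ∷ ((7 , 33) , (19 , 102) , (8 , 39)) ∷
      ((7 , 34) , (14 , 70) , (8 , 42)) ∷ ((7 , 38) , (4 , 20) , (22 , 114)) ∷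
      ((8 , 40) , (7 , 37) , (21 , 106)) ∷ ((9 , 45) , (14 , 73) , (9 , 48)) ∷
      ((9 , 49) , (18 , 88) , (9 , 50)) ∷ ((9 , 51) , (14 , 72) , (11 , 52)) ∷
      ((11 , 54) , (7 , 35) , (18 , 93)) ∷ []
  ; steps =
      (5 , 3) ∷ (11 , 1) ∷ (6 , 1) ∷ (3 , 1) ∷ (5 , 1) ∷ (6 , 1) ∷ (5 , 1) ∷ (8 , 2) ∷
      (10 , 2) ∷ (7 , 1) ∷ (7 , 1) ∷ (9 , 3) ∷ (10 , 1) ∷ (9 , 2) ∷ (7 , 1) ∷ (4 , 1) ∷
      (9 , 2) ∷ (8 , 1) ∷ (5 , 1) ∷ (5 , 1) ∷ (4 , 1) ∷ (6 , 1) ∷ (7 , 2) ∷ (8 , 1) ∷ (6 , 1) ∷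
      (6 , 2) ∷ (10 , 0) ∷ []
  }
template _ = record { strands = [] ; fill = [] ; steps = [] }

small-valid : ∀ {k} → k < 21 → length (small k) ≡ 5 + k × Covering (small k)
small-valid =
  from-yes (allUpTo? (λ k → length (small k) ≟ 5 + k ×-dec covering? (small k)) 21)

template-valid : ∀ {r} → r < 6 → Template.Valid (template r) (26 + r)
template-valid = from-yes (allUpTo? (λ r → Template.valid? (template r) (26 + r)) 6)

small-PSDS : ∀ {k} → k < 21 → PSDSExists (5 + k) 4 3
small-PSDS {k} k<21 =
  subst (λ m → PSDSExists m 4 3) (proj₁ (small-valid k<21))
    (covering⇒PSDS (small k) (proj₂ (small-valid k<21)))

large-PSDS : ∀ {r} → r < 6 → ∀ n → PSDSExists (26 + r + n * 6) 4 3
large-PSDS {r} r<6 = Template.valid⇒PSDS (template r) {26 + r} (template-valid r<6)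

≥5⇒PSDS : ∀ m → m ≥ 5 → PSDSExists m 4 3
≥5⇒PSDS m m≥5 = [ below , above ]′ (<-≤-connex m 26)
  where
  P = λ m → PSDSExists m 4 3

  below : m < 26 → P m
  below m<26 = subst P m≡ (small-PSDS (+-cancelˡ-< 5 (m ∸ 5) 21 (subst (_< 26) (sym m≡) m<26)))
    where
    m≡ : 5 + (m ∸ 5) ≡ m
    m≡ = m+[n∸m]≡n m≥5

  above : m ≥ 26 → P m
  above m≥26 = subst P m≡ (large-PSDS (m%n<n k 6) (k / 6))
    where
    k = m ∸ 26

    m≡ : 26 + k % 6 + k / 6 * 6 ≡ m
    m≡ = trans (+-assoc 26 (k % 6) (k / 6 * 6))
      (trans (cong (26 +_) (sym (m≡m%n+[m/n]*n k 6))) (m+[n∸m]≡n m≥26))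

theorem1p14 : (m : ℕ) → m > 0 → (PSDSExists m 4 3 ⇔ m ≥ 5)
theorem1p14 m m>0 = mk⇔ (PSDS⇒≥5 m m>0) (≥5⇒PSDS m)
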